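{- Let $\mathcal S$ be an arbitrary (not necessarily finite) set with $|\mathcal S|\ge 2$. Let $\mathfrak M$ be the set of all media on $\mathcal S$ and $\mathfrak G$ the set of all mediatic graphs on $\mathcal S$ (that is, with vertex set $\mathcal S$). Then there exists a bijection $\mathfrak f:\mathfrak M\to\mathfrak G$ such that, for every $\mathcal M\in\mathfrak M$, $\mathfrak f(\mathcal M)$ is the graph of $\mathcal M$, and, for all $\mathcal M\in\mathfrak M$ and $G\in\mathfrak G$, $G=\mathfrak f(\mathcal M)$ is the graph of $\mathcal M$ if and only if $\mathcal M$ is the medium of the mediatic graph $G$.
   Context: Token systems. Let $\mathcal S$ be a set of states with $|\mathcal S|\ge 2$. A token is a function $\tau:\mathcal S\to\mathcal S$, written $S\mapsto S\tau$, different from the identity function $\tau_0$ on $\mathcal S$; compositions are written $S\tau_1\tau_2\cdots\tau_n=\tau_n[\cdots\tau_2[\tau_1(S)]\cdots]$. A token system is a pair $(\mathcal S,\mathcal T)$ with $\mathcal T\ne\emptyset$ a set of tokens on $\mathcal S$. For distinct states $S,V$, $V$ is adjacent to $S$ if $S\tau=V$ for some $\tau\in\mathcal T$. A token $\tilde\tau\in\mathcal T$ is a reverse of a token $\tau$ if for any two adjacent states $S,V$ (distinct states, one of which is adjacent to the other) we have $S\tau=V\iff V\tilde\tau=S$. A token has at most one reverse. Messages. A message is a string $\boldsymbol m=\tau_1\ldots\tau_n$ of tokens of $\mathcal T$; it defines the function $S\mapsto S\boldsymbol m=S\tau_1\cdots\tau_n$, and produces $V$ from $S$ if $S\boldsymbol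 m=V$. It is ineffective for $S$ if $S\boldsymbol m=S$; stepwise effective for $S$ if $S\tau_1\cdots\tau_k\ne S\tau_0\cdots\tau_{k-1}$ for $1\le k\le n$; a return (for $S$) if it is both stepwise effective and ineffective for $S$; consistent if it does not contain both a token and its reverse; concise for $S$ if it is consistent, stepwise effective for $S$, and no token occurs in it more than once; vacuous if $\{1,\ldots,n\}$ can be partitioned into pairs $\{i,j\}$ such that $\tau_i,\tau_j$ are mutual reverses. A token system $(\mathcal S,\mathcal T)$ is a medium (on $\mathcal S$) if: [Ma] for any two distinct states $S,V$ there is a concise message producing $V$ from $S$; [Mb] any return message is vacuous. The graph of a medium $(\mathcal S,\mathcal T)$ is the loopless graph $(\mathcal S,E)$ in which, for distinct $S,T\in\mathcal S$, $\{S,T\}\in E\iff(\exists\tau\in\mathcal T)(S\tau=T)$. Like relation. For a graph $G=(V,E)$ let $\vec E=\{ST\mid\{S,T\}\in E\}$ be the set of its arcs (each edge gives the two arcs $ST$ and $TS$), and let $\delta$ be the graph distance. The like relation $\mathfrak L$ is the relation on $\vec E$ defined, for $\{S,T\},\{P,Q\}\in E$, by $$ST\,\mathfrak L\,PQ\iff \delta(S,P)+1=\delta(T,Q)+1=\delta(S,Q)=\delta(T,P).$$ A graph (without loops) is mediatic if it is connected, bipartite, and its like relation $\mathfrak L$ is transitive. The medium of a mediatic graph $G=(\mathcal S,E)$ is the pair $(\mathcal S,\mathcal T)$ with $\mathcal T=\{\tau_{ST}\mid ST\in\vec E\}$, where for each $ST\in\vec E$ the function $\tau_{ST}:\mathcal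 S\to\mathcal S$ is given by $P\tau_{ST}=Q$ if $PQ\in\vec E$ and $ST\,\mathfrak L\,PQ$, and $P\tau_{ST}=P$ if there is no such $Q$. -}

module Defs where

open import Level using (Level; suc)
open import Data.Bool.Base using (Bool)
open import Data.Fin.Base using (Fin; toℕ)
open import Data.List.Base using (List; []; _∷_; foldl; length; lookup; take)
open import Data.List.Membership.Propositional using () renaming (_∈_ to _∈ᴸ_)
open import Data.List.Relation.Unary.AllPairs using (AllPairs)
import Data.Nat.Base as ℕ
open ℕ using (ℕ)
open import Data.Product.Base using (Σ; ∃; ∃₂; _×_; _,_; proj₁; proj₂)
open import Data.Sum.Base using (_⊎_)
open import Function.Base using (id; _∘_)
open import Function.Bundles using (_⇔_)
import Relation.Binary.Core as B
open import Relation.Binary.Bundles using (Setoid)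
open import Relation.Binary.Definitions using (Symmetric; Irreflexive; Transitive; _Respects_)
import Relation.Binary.Construct.On as On
open import Relation.Binary.PropositionalEquality.Core using (_≡_; _≢_; _≗_)
open import Relation.Nullary.Negation.Core using (¬_)
open import Relation.Unary using (Pred; _∈_; Satisfiable)
open import Relation.Unary.Relation.Binary.Equality using (≐-setoid)

-- Functions are compared pointwise (_≗_), so a set of tokens is a predicate on
-- S → S that respects _≗_; sets of tokens and edge relations are compared
-- extensionally.

record TokenSystem {ℓ : Level} (S : Set ℓ) : Set (suc ℓ) where
  field
    𝒯           : Pred (S → S) ℓ
    respects    : 𝒯 Respects _≗_
    nonIdentity : ∀ {τ} → τ ∈ 𝒯 → ¬ (τ ≗ id)
    nonempty    : Satisfiable 𝒯

  AdjacentTo : S → S → Set ℓ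
  AdjacentTo s v = s ≢ v × (∃ λ τ → τ ∈ 𝒯 × τ s ≡ v)

  Adjacent : S → S → Set ℓ
  Adjacent s v = AdjacentTo s v ⊎ AdjacentTo v s

  Token : Set ℓ
  Token = Σ (S → S) 𝒯

  infixl 6 _·_

  _·_ : S → Token → S
  s · τ = proj₁ τ s

  -- ρ is a reverse of τ.
  Reverse : Token → Token → Set ℓ
  Reverse ρ τ = ∀ {s v} → Adjacent s v → (s · τ ≡ v) ⇔ (v · ρ ≡ s)

  MutualReverses : Token → Token → Set ℓ
  MutualReverses τ σ = Reverse τ σ × Reverse σ τ

  Message : Set ℓ
  Message = List Token

  infixl 6 _··_

  _··_ : S → Message → S
  _··_ = foldl _·_

  Produces : Message → S → S → Set ℓ
  Produces m s v = s ·· m ≡ v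

  Ineffective : S → Message → Set ℓ
  Ineffective s m = s ·· m ≡ s

  StepwiseEffective : S → Message → Set ℓ
  StepwiseEffective s m =
    ∀ (k : Fin (length m)) → s ·· take (ℕ.suc (toℕ k)) m ≢ s ·· take (toℕ k) m

  Return : S → Message → Set ℓ
  Return s m = StepwiseEffective s m × Ineffective s m

  -- τ and ρ may coincide: a token that is its own reverse occurs in no
  -- consistent message.
  Consistent : Message → Set ℓ
  Consistent m = ∀ {τ ρ} → τ ∈ᴸ m → ρ ∈ᴸ m → ¬ Reverse ρ τ

  NoRepetition : Message → Set ℓ
  NoRepetition = AllPairs (λ τ σ → ¬ (proj₁ τ ≗ proj₁ σ))

  Concise : S → Message → Set ℓ
  Concise s m = Consistent m × StepwiseEffective s m × NoRepetition m

  -- A partition of the positions into pairs is a fixed-point-free involution π,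
  -- the pairs being {i , π i}.
  Vacuous : Message → Set ℓ
  Vacuous m = ∃ λ (π : Fin (length m) → Fin (length m)) →
    (∀ i → π i ≢ i) × (∀ i → π (π i) ≡ i) ×
    (∀ i → MutualReverses (lookup m i) (lookup m (π i)))

record Medium {ℓ : Level} (S : Set ℓ) : Set (suc ℓ) where
  field
    tokenSystem : TokenSystem S
  open TokenSystem tokenSystem public
  field
    Ma : ∀ {s v} → s ≢ v → ∃ λ m → Concise s m × Produces m s v
    Mb : ∀ {s m} → Return s m → Vacuous m

record Graph {ℓ : Level} (S : Set ℓ) : Set (suc ℓ) where
  infix 4 _~_
  field
    _~_      : B.Rel S ℓ
    sym      : Symmetric _~_
    loopless : Irreflexive _≡_ _~_

  data Walk : S → S → ℕ → Set ℓ where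
    []  : ∀ {s} → Walk s s 0
    _∷_ : ∀ {s t u n} → s ~ t → Walk t u n → Walk s u (ℕ.suc n)

  -- δ(s , t) = n.  The distance is a relation, because no function computing
  -- it is definable constructively.
  Distance : S → S → ℕ → Set ℓ
  Distance s t n = Walk s t n × (∀ {k} → Walk s t k → n ℕ.≤ k)

  Connected : Set ℓ
  Connected = ∀ s t → ∃ (Walk s t)

  Bipartite : Set ℓ
  Bipartite = ∃ λ (colour : S → Bool) → ∀ {s t} → s ~ t → colour s ≢ colour t

  record Arc : Set ℓ where
    eta-equality
    constructor arc
    field
      {source target} : S
      edge            : source ~ target

  Like : B.Rel Arc ℓ
  Like (arc {s} {t} _) (arc {p} {q} _) = ∃ λ n →
    Distance s p n × Distance t q n ×
    Distance s q (n ℕ.+ 1) × Distance t p (n ℕ.+ 1)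

  -- τ is the function τ_ST of the arc ST = a.
  record IsTokenOf (a : Arc) (τ : S → S) : Set ℓ where
    field
      moves : ∀ {p q} (e : p ~ q) → Like a (arc e) → τ p ≡ q
      fixes : ∀ {p} → ¬ (∃₂ λ q (e : p ~ q) → Like a (arc e)) → τ p ≡ p

record MediaticGraph {ℓ : Level} (S : Set ℓ) : Set (suc ℓ) where
  field
    graph : Graph S
  open Graph graph public
  field
    connected      : Connected
    bipartite      : Bipartite
    likeTransitive : Transitive Like

mediumSetoid : ∀ {ℓ} → Set ℓ → Setoid (suc ℓ) ℓ
mediumSetoid {ℓ} S =
  On.setoid {B = Medium S} (≐-setoid (S → S) ℓ) Medium.𝒯

infix 4 _≈ᴳ_

_≈ᴳ_ : ∀ {ℓ} {S : Set ℓ} → MediaticGraph S → MediaticGraph S → Set ℓ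
G ≈ᴳ H = MediaticGraph._~_ G B.⇔ MediaticGraph._~_ H

mediaticGraphSetoid : ∀ {ℓ} → Set ℓ → Setoid (suc ℓ) ℓ
mediaticGraphSetoid S = record
  { Carrier       = MediaticGraph S
  ; _≈_           = _≈ᴳ_
  ; isEquivalence = record
    { refl  = id , id
    ; sym   = λ (f , g) → g , f
    ; trans = λ (f , g) (h , k) → h ∘ f , g ∘ k
    }
  }

_IsGraphOf_ : ∀ {ℓ} {S : Set ℓ} → MediaticGraph S → Medium S → Set ℓ
G IsGraphOf M = ∀ {s t} → s ≢ t → (s ~ t) ⇔ (∃ λ τ → τ ∈ 𝒯 × τ s ≡ t)
  where
  open MediaticGraph G
  open Medium M

-- 𝒯 = { τ_ST ∣ ST an arc of G }, including that each function τ_ST exists.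
_IsMediumOf_ : ∀ {ℓ} {S : Set ℓ} → Medium S → MediaticGraph S → Set ℓ
M IsMediumOf G =
  (∀ {τ} → τ ∈ 𝒯 → ∃ λ a → IsTokenOf a τ) ×
  (∀ a → ∃ λ τ → IsTokenOf a τ × τ ∈ 𝒯)
  where
  open MediaticGraph G
  open Medium M

{-# OPTIONS --safe #-}
module Submission where

-- In a medium the return messages, being vacuous, use each token as often as its reverse. Hence
-- any two stepwise effective messages between the same states agree on the number of uses of a
-- token minus those of its reverse, the concise messages are the shortest ones, and ST 𝔏 PQ holds
-- exactly when one token moves S to T and P to Q; this makes 𝔏 transitive and identifies the
-- medium with the medium of its graph. Conversely, in a bipartite graph ST 𝔏 PQ holds exactly when
-- PQ leaves the halfspace { P ∣ δ(P,S) < δ(P,T) }. A closed walk leaves and enters each halfspace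
-- equally often, so returns are vacuous, and a shortest walk never crosses twice between the same
-- two halfspaces, so it gives a concise message.

open import Defs
open import Axiom.DoubleNegationElimination using (em⇒dne)
open import Axiom.ExcludedMiddle using (ExcludedMiddle)
open import Data.Bool.Base using (Bool; true; false; not; _xor_)
open import Data.Bool.Properties using (¬-not; not-distribˡ-xor; not-injective; xor-same)
open import Data.Empty using (⊥-elim)
open import Data.Fin.Base as Fin using (Fin; zero; suc)
open import Data.Fin.Permutation using (permutation; inverseˡ; inverseʳ; _⟨$⟩ˡ_; _⟨$⟩ʳ_)
import Data.Fin.Properties as Fin
open import Data.List.Base using (List; []; _∷_; _++_; [_]; length; lookup; map)
open import Data.List.Membership.Propositional using (_∈_; find)
open import Data.List.Membership.Propositional.Properties using (∈-∃++; ∈-lookup)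
open import Data.List.Properties using (foldl-++; length-++; map-++)
import Data.List.Relation.Binary.Permutation.Homogeneous as Homogeneous
open import Data.List.Relation.Binary.Permutation.Propositional using (_↭_; prep; ↭⇒↭ₛ; ↭-sym)
open import Data.List.Relation.Binary.Permutation.Propositional.Properties using (map⁺; shift; ↭-length)
open import Data.List.Relation.Binary.Permutation.Setoid.Properties using (onIndices-lookup)
open import Data.List.Relation.Unary.All as All using (All; []; _∷_)
open import Data.List.Relation.Unary.AllPairs as AllPairs using (AllPairs; []; _∷_)
open import Data.List.Relation.Unary.Any using (Any; here; there)
open import Data.Nat.Base
open import Data.Nat.Induction using (<-rec)
open import Data.Nat.ListAction using (sum)
open import Data.Nat.ListAction.Properties using (sum-++; sum-↭)
open import Data.Nat.Properties
open import Algebra.Properties.CommutativeMonoid.Sum +-0-commutativeMonoid as Σᶠ using (∑-distrib-+; sum-cong-≗; sum-permute)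
open import Algebra.Properties.CommutativeSemigroup +-commutativeSemigroup using (interchange)
open import Data.Product.Base using (Σ; ∃; ∃₂; _×_; _,_; proj₁; proj₂)
open import Data.Sum.Base as Sum using (_⊎_; inj₁; inj₂; fromInj₁; fromInj₂)
open import Data.Unit.Polymorphic.Base using (⊤; tt)
open import Function.Base using (_∘_; _$_)
open import Function.Bundles using (Bijection; Equivalence; _⇔_; mk⇔)
open import Level using (Level; Lift; lift; lower)
open import Relation.Binary.Bundles using (Setoid)
open import Relation.Binary.Core using (Rel)
open import Relation.Binary.Definitions using (Reflexive; Symmetric; Transitive; tri<; tri≈; tri>)
open import Relation.Binary.PropositionalEquality hiding ([_])
open import Relation.Binary.Structures using (IsEquivalence)
open import Relation.Nullary using (Dec; yes; no; ¬_; contradiction)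
open import Relation.Unary using (Pred)

-- Fixed-point-free pairings of the positions of a list.

module _ {a r : Level} {A : Set a} where

  -- `Vacuous m` unfolds to `Matched MutualReverses m`; abstracting from tokens lets both directions
  -- of the theorem share the combinatorics.
  Matched : Rel A r → List A → Set r
  Matched R xs = ∃ λ (π : Fin (length xs) → Fin (length xs)) →
    (∀ i → π i ≢ i) × (∀ i → π (π i) ≡ i) × (∀ i → R (lookup xs i) (lookup xs (π i)))

  module _ (R : Rel A r) where

    matched-[] : Matched R []
    matched-[] = (λ ()) , (λ ()) , (λ ()) , (λ ())

    matched-∷∷ : ∀ {x y} xs → R x y → R y x → Matched R xs → Matched R (x ∷ y ∷ xs)
    matched-∷∷ {x} {y} xs xy yx (π , fpf , inv , rel) = π′ , fpf′ , inv′ , rel′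
      where
      π′ : Fin (length (x ∷ y ∷ xs)) → Fin (length (x ∷ y ∷ xs))
      π′ zero          = suc zero
      π′ (suc zero)    = zero
      π′ (suc (suc i)) = suc (suc (π i))
      fpf′ : ∀ i → π′ i ≢ i
      fpf′ zero          ()
      fpf′ (suc zero)    ()
      fpf′ (suc (suc i)) eq = fpf i (Fin.suc-injective (Fin.suc-injective eq))
      inv′ : ∀ i → π′ (π′ i) ≡ i
      inv′ zero          = refl
      inv′ (suc zero)    = refl
      inv′ (suc (suc i)) = cong (λ j → suc (suc j)) (inv i)
      rel′ : ∀ i → R (lookup (x ∷ y ∷ xs) i) (lookup (x ∷ y ∷ xs) (π′ i))
      rel′ zero          = xy
      rel′ (suc zero)    = yx
      rel′ (suc (suc i)) = rel i

    -- The involution is conjugated by the bijection of positions that the permutation induces.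
    matched-↭ : ∀ {xs ys} → xs ↭ ys → Matched R xs → Matched R ys
    matched-↭ {xs} {ys} xs↭ys (π , fpf , inv , rel) =
      to ∘ π ∘ from
      , (λ i eq → fpf (from i) (trans (sym (inverseˡ φ)) (cong from eq)))
      , (λ i → trans (cong (to ∘ π) (inverseˡ φ)) (trans (cong to (inv (from i))) (inverseʳ φ)))
      , λ i → subst₂ R (trans (look (from i)) (cong (lookup ys) (inverseʳ φ))) (look (π (from i))) (rel (from i))
      where
      p    = ↭⇒↭ₛ xs↭ys
      φ    = Homogeneous.onIndices p
      to   = φ ⟨$⟩ʳ_
      from = φ ⟨$⟩ˡ_
      look : ∀ i → lookup xs i ≡ lookup ys (to i)
      look = onIndices-lookup (setoid A) p

sum-involution : ∀ {n} {π : Fin n → Fin n} → (∀ i → π (π i) ≡ i) →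
                 (f : Fin n → ℕ) → Σᶠ.sum (f ∘ π) ≡ Σᶠ.sum f
sum-involution {π = π} inv f =
  sym (sum-permute f (permutation π π inv inv))

-- Counting list entries with classical characteristic functions.

module Classical {ℓ : Level} (em : ExcludedMiddle ℓ) where

  χ : Set ℓ → ℕ
  χ P with em {P}
  ... | yes _ = 1
  ... | no  _ = 0

  χ-yes : ∀ {P} → P → χ P ≡ 1
  χ-yes {P} p with em {P}
  ... | yes _  = refl
  ... | no  ¬p = contradiction p ¬p

  χ-no : ∀ {P} → ¬ P → χ P ≡ 0
  χ-no {P} ¬p with em {P}
  ... | yes p = contradiction p ¬p
  ... | no  _ = refl

  χ-cong : ∀ {P Q} → (P → Q) → (Q → P) → χ P ≡ χ Q
  χ-cong {P} {Q} f g with em {P}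
  ... | yes p = sym (χ-yes (f p))
  ... | no ¬p = sym (χ-no (¬p ∘ g))

  module _ {A : Set ℓ} where

    count : Pred A ℓ → List A → ℕ
    count P xs = sum (map (χ ∘ P) xs)

    count-++ : ∀ P xs ys → count P (xs ++ ys) ≡ count P xs + count P ys
    count-++ P xs ys = trans (cong sum (map-++ (χ ∘ P) xs ys)) (sum-++ (map (χ ∘ P) xs) _)

    count-↭ : ∀ P {xs ys} → xs ↭ ys → count P xs ≡ count P ys
    count-↭ P p = sum-↭ (map⁺ (χ ∘ P) p)

    count-cong : ∀ {P Q} → (∀ x → P x → Q x) → (∀ x → Q x → P x) → ∀ xs → count P xs ≡ count Q xs
    count-cong f g []       = refl
    count-cong f g (x ∷ xs) = cong₂ _+_ (χ-cong (f x) (g x)) (count-cong f g xs)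

    count-lookup : ∀ P xs → count P xs ≡ Σᶠ.sum (λ i → χ (P (lookup xs i)))
    count-lookup P []       = refl
    count-lookup P (x ∷ xs) = cong (χ (P x) +_) (count-lookup P xs)

    count⇒any : ∀ P xs → 1 ≤ count P xs → Any P xs
    count⇒any P (x ∷ xs) 1≤ with em {P x}
    ... | yes p = here p
    ... | no  _ = there (count⇒any P xs 1≤)

    any⇒count : ∀ P {xs} → Any P xs → 1 ≤ count P xs
    any⇒count P {x ∷ xs} (here p)  rewrite χ-yes p = s≤s z≤n
    any⇒count P {x ∷ xs} (there i) = ≤-trans (any⇒count P i) (m≤n+m _ (χ (P x)))

    module _ (R : Rel A ℓ) where

      -- Position `i` counts for `P` exactly if position `π i` counts for `Q`, and `π` permutes the
      -- positions.
      matched-count : ∀ P Q xs → (∀ {x y} → R x y → χ (P x) ≡ χ (Q y)) →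
                      Matched R xs → count P xs ≡ count Q xs
      matched-count P Q xs swap (π , _ , inv , rel) = begin
        count P xs                              ≡⟨ count-lookup P xs ⟩
        Σᶠ.sum (λ i → χ (P (lookup xs i)))      ≡⟨ sum-cong-≗ (swap ∘ rel) ⟩
        Σᶠ.sum (λ i → χ (Q (lookup xs (π i))))  ≡⟨ sum-involution inv (χ ∘ Q ∘ lookup xs) ⟩
        Σᶠ.sum (λ i → χ (Q (lookup xs i)))      ≡⟨ count-lookup Q xs ⟨
        count Q xs                              ∎
        where open ≡-Reasoning

    -- Every pair {i , π i} contributes exactly one index i with i < π i.
    matched-even : ∀ (R : Rel A ℓ) xs → Matched R xs → ∃ λ k → length xs ≡ k + k
    matched-even R xs (π , fpf , inv , _) = Σᶠ.sum small , (begin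
        length xs                                ≡⟨ ones (length xs) ⟩
        Σᶠ.sum (λ (i : Fin (length xs)) → 1)      ≡⟨ sum-cong-≗ one ⟩
        Σᶠ.sum (λ i → small i + small (π i))      ≡⟨ ∑-distrib-+ small (small ∘ π) ⟩
        Σᶠ.sum small + Σᶠ.sum (small ∘ π)         ≡⟨ cong (Σᶠ.sum small +_) (sum-involution inv small) ⟩
        Σᶠ.sum small + Σᶠ.sum small               ∎)
      where
      open ≡-Reasoning
      small : Fin (length xs) → ℕ
      small i with Fin.<-cmp i (π i)
      ... | tri< _ _ _ = 1
      ... | tri≈ _ _ _ = 0
      ... | tri> _ _ _ = 0
      ones : ∀ n → n ≡ Σᶠ.sum (λ (i : Fin n) → 1)
      ones zero    = refl
      ones (suc n) = cong suc (ones n)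
      one : ∀ i → 1 ≡ small i + small (π i)
      one i with Fin.<-cmp i (π i) | Fin.<-cmp (π i) (π (π i))
      ... | tri< lt _ _   | tri< lt′ _ _ = contradiction (subst (π i Fin.<_) (inv i) lt′) (Fin.<-asym lt)
      ... | tri< _ _ _    | tri≈ _ _ _  = refl
      ... | tri< _ _ _    | tri> _ _ _  = refl
      ... | tri≈ _ eq _   | _           = contradiction (sym eq) (fpf i)
      ... | tri> _ _ _    | tri< _ _ _  = refl
      ... | tri> _ _ _    | tri≈ _ eq _ = contradiction (sym eq) (fpf (π i))
      ... | tri> _ _ gt   | tri> _ _ gt′ = contradiction (subst (Fin._< π i) (inv i) gt′) (Fin.<-asym gt)

    module Extraction {_≈_ : Rel A ℓ} (isEquivalence : IsEquivalence _≈_) where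

      private module ≈ = IsEquivalence isEquivalence

      extract : ∀ {z} xs → 1 ≤ count (_≈ z) xs → ∃₂ λ y ys → y ≈ z × xs ↭ y ∷ ys
      extract {z} xs 1≤ with y , y∈xs , y≈z ← find (count⇒any (_≈ z) xs 1≤)
                        with as , bs , refl ← ∈-∃++ y∈xs = y , as ++ bs , y≈z , shift y as bs

      χ-resp : ∀ {x y z} → x ≈ y → χ (x ≈ z) ≡ χ (y ≈ z)
      χ-resp x≈y = χ-cong (≈.trans (≈.sym x≈y)) (≈.trans x≈y)

      -- Each entry of `xs` is cancelled against an equivalent entry of `ys`, which lowers both
      -- sides of every inequality by the same amount.
      count-mono⇒length-mono : ∀ xs ys → (∀ z → count (_≈ z) xs ≤ count (_≈ z) ys) → length xs ≤ length ys
      count-mono⇒length-mono []       ys le = z≤n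
      count-mono⇒length-mono (x ∷ xs) ys le
        with y , ys′ , y≈x , perm ← extract ys (≤-trans (any⇒count (_≈ x) {x ∷ xs} (here ≈.refl)) (le x)) =
        subst (suc (length xs) ≤_) (sym (↭-length perm)) (s≤s (count-mono⇒length-mono xs ys′ le′))
        where
        le′ : ∀ z → count (_≈ z) xs ≤ count (_≈ z) ys′
        le′ z = +-cancelˡ-≤ (χ (x ≈ z)) _ _ (begin
          count (_≈ z) (x ∷ xs)         ≤⟨ le z ⟩
          count (_≈ z) ys               ≡⟨ count-↭ (_≈ z) perm ⟩
          count (_≈ z) (y ∷ ys′)        ≡⟨ cong (_+ count (_≈ z) ys′) (χ-resp y≈x) ⟩
          χ (x ≈ z) + count (_≈ z) ys′  ∎)
          where open ≤-Reasoning

  -- Lists using each element as often as its reverse.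

  module Balance {A : Set ℓ} {_≈_ : Rel A ℓ} (isEquivalence : IsEquivalence _≈_)
    (rev : A → A) (rev-cong : ∀ {x y} → x ≈ y → rev x ≈ rev y)
    (rev-involutive : ∀ x → rev (rev x) ≈ x) (rev-≉ : ∀ {x} → ¬ (x ≈ rev x))
    where

    private module ≈ = IsEquivalence isEquivalence
    open Extraction isEquivalence public

    # : A → List A → ℕ
    # z xs = count (_≈ z) xs

    Balanced : List A → Set ℓ
    Balanced xs = ∀ z → # z xs ≡ # (rev z) xs

    swap-rev : ∀ {x y} → x ≈ rev y → rev x ≈ y
    swap-rev x≈ỹ = ≈.trans (rev-cong x≈ỹ) (rev-involutive _)

    χ-rev : ∀ {x y z} → x ≈ rev y → χ (x ≈ z) ≡ χ (y ≈ rev z)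
    χ-rev x≈ỹ = χ-cong
      (λ x≈z → ≈.trans (≈.sym (swap-rev x≈ỹ)) (rev-cong x≈z))
      (λ y≈z̃ → ≈.trans x≈ỹ (swap-rev y≈z̃))

    matched⇒balanced : ∀ (R : Rel A ℓ) xs → (∀ {x y} → R x y → x ≈ rev y) → Matched R xs → Balanced xs
    matched⇒balanced R xs R⇒rev μ z = matched-count R _ _ xs (χ-rev ∘ R⇒rev) μ

    -- Greedy pairing: the head is matched with an occurrence of its reverse in the tail, and
    -- removing both keeps the list balanced.
    balanced⇒matched : ∀ (R : Rel A ℓ) xs → (∀ {x y} → x ≈ rev y → R x y) → Balanced xs → Matched R xs
    balanced⇒matched R xs rev⇒R = go (length xs) xs ≤-refl
      where
      -- The remaining list comes out of a permutation and is no subterm of the given one, so the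
      -- recursion runs on a bound `n` for the length.
      go : ∀ n xs → length xs ≤ n → Balanced xs → Matched R xs
      go n       []       _         _   = matched-[] R
      go (suc n) (x ∷ xs) (s≤s len) bal = split (extract xs x̃-occurs)
        where
        open ≡-Reasoning
        x̃-occurs : 1 ≤ # (rev x) xs
        -- The head contributes nothing to the count of `rev x`, by `rev-≉`, so the whole count
        -- comes from the tail.
        x̃-occurs = subst (1 ≤_)
          (trans (bal x) (cong (_+ # (rev x) xs) (χ-no rev-≉)))
          (any⇒count (_≈ x) {x ∷ xs} (here ≈.refl))
        split : (∃₂ λ y zs → y ≈ rev x × xs ↭ y ∷ zs) → Matched R (x ∷ xs)
        split (y , zs , y≈x̃ , perm) =
          matched-↭ R (↭-sym (prep x perm))
            (matched-∷∷ R zs (rev⇒R x≈ỹ) (rev⇒R y≈x̃) (go n zs shorter rest-balanced))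
          where
          x≈ỹ : x ≈ rev y
          x≈ỹ = ≈.sym (swap-rev y≈x̃)
          shorter : length zs ≤ n
          shorter = ≤-trans (n≤1+n _) (subst (_≤ n) (↭-length perm) len)
          rest-balanced : Balanced zs
          rest-balanced z = +-cancelˡ-≡ (χ (x ≈ z) + χ (y ≈ z)) _ _ $ begin
            χ (x ≈ z) + χ (y ≈ z) + # z zs
              ≡⟨ +-assoc (χ (x ≈ z)) _ _ ⟩
            # z (x ∷ y ∷ zs)
              ≡⟨ count-↭ (_≈ z) (prep x perm) ⟨
            # z (x ∷ xs)
              ≡⟨ bal z ⟩
            # (rev z) (x ∷ xs)
              ≡⟨ count-↭ (_≈ rev z) (prep x perm) ⟩
            # (rev z) (x ∷ y ∷ zs)
              ≡⟨ +-assoc (χ (x ≈ rev z)) _ _ ⟨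
            χ (x ≈ rev z) + χ (y ≈ rev z) + # (rev z) zs
              ≡⟨ cong (_+ # (rev z) zs) (cong₂ _+_ (χ-rev y≈x̃) (χ-rev x≈ỹ)) ⟨
            χ (y ≈ z) + χ (x ≈ z) + # (rev z) zs
              ≡⟨ cong (_+ # (rev z) zs) (+-comm (χ (y ≈ z)) _) ⟩
            χ (x ≈ z) + χ (y ≈ z) + # (rev z) zs ∎

isOdd : ℕ → Bool
isOdd zero    = false
isOdd (suc n) = not (isOdd n)

isOdd-+ : ∀ m n → isOdd (m + n) ≡ isOdd m xor isOdd n
isOdd-+ zero    n = refl
isOdd-+ (suc m) n = trans (cong not (isOdd-+ m n)) (not-distribˡ-xor (isOdd m) (isOdd n))

open Equivalence using (to; from)

-- Tokens up to pointwise equality, effective messages and reverses.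

module Tokens {ℓ : Level} (em : ExcludedMiddle ℓ) {S : Set ℓ} (T : TokenSystem S) where

  open TokenSystem T
  open Classical em

  infix 4 _≈_
  _≈_ : Token → Token → Set ℓ
  x ≈ y = proj₁ x ≗ proj₁ y

  ≈-isEquivalence : IsEquivalence _≈_
  ≈-isEquivalence = record
    { refl  = λ _ → refl
    ; sym   = λ p s → sym (p s)
    ; trans = λ p q s → trans (p s) (q s)
    }

  module ≈ = IsEquivalence ≈-isEquivalence

  -- Stepwise effectiveness by recursion on the message instead of through prefixes, as induction on
  -- messages requires.
  Effective : S → Message → Set ℓ
  Effective s []      = ⊤
  Effective s (x ∷ m) = s · x ≢ s × Effective (s · x) m

  stepwise⇒effective : ∀ {s} m → StepwiseEffective s m → Effective s m
  stepwise⇒effective []      _   = tt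
  stepwise⇒effective (x ∷ m) eff = eff zero , stepwise⇒effective m (eff ∘ suc)

  effective⇒stepwise : ∀ {s} m → Effective s m → StepwiseEffective s m
  effective⇒stepwise (x ∷ m) (ne , eff) zero    = ne
  effective⇒stepwise (x ∷ m) (ne , eff) (suc k) = effective⇒stepwise m eff k

  effective-++ : ∀ {s} m {m′} → Effective s m → Effective (s ·· m) m′ → Effective s (m ++ m′)
  effective-++ []      _          eff′ = eff′
  effective-++ (x ∷ m) (ne , eff) eff′ = ne , effective-++ m eff eff′

  moved : (x : Token) → ∃ λ s → s · x ≢ s
  moved (τ , τ∈𝒯) = em⇒dne em λ none →
    nonIdentity τ∈𝒯 λ s → em⇒dne em λ τs≢s → none (s , τs≢s)

  adjacent : ∀ {s v} x → s ≢ v → s · x ≡ v → Adjacent s v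
  adjacent x s≢v sx≡v = inj₁ (s≢v , proj₁ x , proj₂ x , sx≡v)

  reverse-sym : ∀ {x y} → Reverse x y → Reverse y x
  reverse-sym r adj = mk⇔ (from (r (Sum.swap adj))) (to (r (Sum.swap adj)))

  reverse-resp-≈ : ∀ {x x′ y y′} → x ≈ x′ → y ≈ y′ → Reverse x y → Reverse x′ y′
  reverse-resp-≈ xx yy r {s} {v} adj = mk⇔
    (λ e → trans (sym (xx v)) (to (r adj) (trans (yy s) e)))
    (λ e → trans (sym (yy s)) (from (r adj) (trans (xx v) e)))

  -- A token that moves v to s makes s and v adjacent, so all reverses of a token agree where they move.
  reverse-unique : ∀ {x y z} → Reverse x z → Reverse y z → x ≈ y
  reverse-unique {x} {y} {z} rx ry v with em {v · x ≡ v} | em {v · y ≡ v}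
  ... | yes p | yes q = trans p (sym q)
  ... | no  p | _     = sym (to (ry adj) (from (rx adj) refl))
    where adj = Sum.swap (adjacent x (p ∘ sym) refl)
  ... | yes _ | no q  = to (rx adj) (from (ry adj) refl)
    where adj = Sum.swap (adjacent y (q ∘ sym) refl)

  -- Both directions instantiate this: for a medium `rev` is extracted from the axioms, for a
  -- mediatic graph it comes from reversing arcs.
  module Reversible (rev : Token → Token) (rev-reverse : ∀ x → Reverse (rev x) x)
                    (rev-≉ : ∀ {x} → ¬ (x ≈ rev x)) where

    rev-cong : ∀ {x y} → x ≈ y → rev x ≈ rev y
    rev-cong {x} {y} x≈y = reverse-unique {rev x} {rev y} {y}
      (reverse-resp-≈ {rev x} {rev x} {x} {y} (λ _ → refl) x≈y (rev-reverse x)) (rev-reverse y)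

    rev-involutive : ∀ x → rev (rev x) ≈ x
    rev-involutive x = reverse-unique {rev (rev x)} {x} {rev x}
      (rev-reverse (rev x)) (reverse-sym {rev x} {x} (rev-reverse x))

    open Balance ≈-isEquivalence rev rev-cong rev-involutive rev-≉ public

    reverse⇒≈ : ∀ {x y} → Reverse x y → x ≈ rev y
    reverse⇒≈ {x} {y} r = reverse-unique {x} {rev y} {y} r (rev-reverse y)

    ≈⇒reverse : ∀ {x y} → x ≈ rev y → Reverse x y
    ≈⇒reverse {x} {y} x≈ỹ =
      reverse-resp-≈ {rev y} {x} {y} {y} (≈.sym {x} {rev y} x≈ỹ) (λ _ → refl) (rev-reverse y)

    vacuous⇒balanced : ∀ m → Vacuous m → Balanced m
    vacuous⇒balanced m = matched⇒balanced MutualReverses m (λ {x} {y} → reverse⇒≈ {x} {y} ∘ proj₁)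

    balanced⇒vacuous : ∀ m → Balanced m → Vacuous m
    balanced⇒vacuous m = balanced⇒matched MutualReverses m λ {x} {y} x≈ỹ →
      ≈⇒reverse {x} {y} x≈ỹ , reverse-sym {x} {y} (≈⇒reverse {x} {y} x≈ỹ)

    back : ∀ {s v} x → s ≢ v → s · x ≡ v → v · rev x ≡ s
    back x s≢v sx≡v = to (rev-reverse x (adjacent x s≢v sx≡v)) sx≡v

-- Walks and distances in a graph.

module Walks {ℓ : Level} {S : Set ℓ} (G : Graph S) where

  open Graph G renaming (sym to ~-sym)

  walk-++ : ∀ {s t v m n} → Walk s t m → Walk t v n → Walk s v (m + n)
  walk-++ []      w′ = w′
  walk-++ (e ∷ w) w′ = e ∷ walk-++ w w′

  walk-reverse : ∀ {s t n} → Walk s t n → Walk t s n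
  walk-reverse []                  = []
  walk-reverse {n = suc n} (e ∷ w) =
    subst (Walk _ _) (+-comm n 1) (walk-++ (walk-reverse w) (~-sym e ∷ []))

  distance-sym : ∀ {s t n} → Distance s t n → Distance t s n
  distance-sym (w , min) = walk-reverse w , min ∘ walk-reverse

  distance-unique : ∀ {s t m n} → Distance s t m → Distance s t n → m ≡ n
  distance-unique (w , min) (w′ , min′) = ≤-antisym (min w′) (min′ w)

  like-sym : Symmetric Like
  like-sym (n , δsp , δtq , δsq , δtp) =
    n , distance-sym δsp , distance-sym δtq , distance-sym δtp , distance-sym δsq

-- From a medium to its graph: balances of tokens along paths.

module MediumGraph {ℓ : Level} (em : ExcludedMiddle ℓ) {S : Set ℓ} (M : Medium S) (root : S) where

  open Medium M
  open Classical em
  open Tokens em tokenSystem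

  abstract
    -- The return x m, where m is concise, is vacuous: x is paired with a token of m.
    reversal : (x : Token) → ∃ λ ρ → Reverse ρ x × ¬ (x ≈ ρ)
    reversal x with s , sx≢s ← moved x with m , (cons , eff , _) , prod ← Ma sx≢s
      with Mb {s} {x ∷ m} (effective⇒stepwise (x ∷ m) (sx≢s , stepwise⇒effective m eff) , prod)
    ... | π , fpf , _ , rel = at (π zero) (fpf zero) (rel zero)
      where
      at : ∀ i → i ≢ zero → MutualReverses x (lookup (x ∷ m) i) → ∃ λ ρ → Reverse ρ x × ¬ (x ≈ ρ)
      at zero    i≢0 _       = contradiction refl i≢0
      -- If `x` agreed with `ρ`, then `ρ` would be its own reverse, and the concise message `m`, in
      -- which it occurs, would be inconsistent.
      at (suc i) _   (_ , r) = ρ , r , λ x≈ρ →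
        cons (∈-lookup i) (∈-lookup i) (reverse-resp-≈ {ρ} {ρ} {x} {ρ} (λ _ → refl) x≈ρ r)
        where
        ρ : Token
        ρ = lookup m i

  rev : Token → Token
  rev x = proj₁ (reversal x)

  rev-≉ : ∀ {x} → ¬ (x ≈ rev x)
  rev-≉ {x} = proj₂ (proj₂ (reversal x))

  open Reversible rev (proj₁ ∘ proj₂ ∘ reversal) (λ {x} → rev-≉ {x})

  record Path (s v : S) : Set ℓ where
    constructor path
    field
      message   : Message
      effective : Effective s message
      produces  : s ·· message ≡ v

  open Path

  infixr 5 _++ₚ_
  _++ₚ_ : ∀ {s t v} → Path s t → Path t v → Path s v
  _++ₚ_ {s} p q = path (message p ++ message q)
    (effective-++ (message p) (effective p)
      (subst (λ t → Effective t (message q)) (sym (produces p)) (effective q)))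
    (trans (foldl-++ _·_ s (message p) (message q))
      (trans (cong (_·· message q) (produces p)) (produces q)))

  step : ∀ {s t} x → s ≢ t → s · x ≡ t → Path s t
  step x s≢t sx≡t = path [ x ] ((λ sx≡s → s≢t (trans (sym sx≡s) sx≡t)) , tt) sx≡t

  ∣_∣ₚ : ∀ {s v} → Path s v → ℕ
  ∣ p ∣ₚ = length (message p)

  #ₚ : ∀ {s v} → Token → Path s v → ℕ
  #ₚ z p = # z (message p)

  -- Conciseness in terms of counts only.
  Thin : ∀ {s v} → Path s v → Set ℓ
  Thin p = ∀ z → #ₚ z p + #ₚ (rev z) p ≤ 1

  closed-vacuous : ∀ {s} (p : Path s s) → Vacuous (message p)
  closed-vacuous (path m eff prod) = Mb (effective⇒stepwise m eff , prod)

  -- Going out by `x` and back by `rev y` is a return of length two. The only possible pairing makes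
  -- `x` a reverse of `rev y`, that is, equal to `y`.
  same-step : ∀ {s t x y} → s ≢ t → s · x ≡ t → s · y ≡ t → x ≈ y
  same-step {s} {t} {x} {y} s≢t sx≡t sy≡t
    with π , fpf , _ , rel ←
      closed-vacuous (step x s≢t sx≡t ++ₚ step (rev y) (s≢t ∘ sym) (back y s≢t sy≡t))
    = at (π zero) (fpf zero) (rel zero)
    where
    at : ∀ i → i ≢ zero → MutualReverses x (lookup (x ∷ rev y ∷ []) i) → x ≈ y
    at zero       i≢0 _       = contradiction refl i≢0
    at (suc zero) _   (r , _) = ≈.trans {x} {rev (rev y)} {y} (reverse⇒≈ {x} {rev y} r) (rev-involutive y)

  noRepetition⇒count≤1 : ∀ {m} → NoRepetition m → ∀ z → # z m ≤ 1
  noRepetition⇒count≤1 []        z = z≤n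
  noRepetition⇒count≤1 {x ∷ m} (x≉ ∷ nr) z with em {x ≈ z}
  ... | no  _   = noRepetition⇒count≤1 nr z
  ... | yes x≈z = s≤s (≮⇒≥ absent)
    where
    absent : ¬ (1 ≤ # z m)
    absent 1≤ with y , y∈m , y≈z ← find (count⇒any (_≈ z) m 1≤) =
      All.lookup x≉ y∈m λ s → trans (x≈z s) (sym (y≈z s))

  -- Without repetitions each of the two counts is at most one, and consistency forbids that both
  -- are positive.
  concise⇒thin : ∀ {m} → Consistent m → NoRepetition m → ∀ z → # z m + # (rev z) m ≤ 1
  concise⇒thin {m} cons nr z = bound _ _ (noRepetition⇒count≤1 nr z) (noRepetition⇒count≤1 nr (rev z)) both
    where
    both : 1 ≤ # z m → 1 ≤ # (rev z) m → # z m + # (rev z) m ≤ 1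
    both p q with x , x∈m , x≈z ← find (count⇒any (_≈ z) m p)
             with y , y∈m , y≈z̃ ← find (count⇒any (_≈ rev z) m q) =
      ⊥-elim (cons {x} {y} x∈m y∈m (reverse-resp-≈ {rev z} {y} {z} {x}
        (≈.sym {y} {rev z} y≈z̃) (≈.sym {x} {z} x≈z) (proj₁ (proj₂ (reversal z)))))
    bound : ∀ a b → a ≤ 1 → b ≤ 1 → (1 ≤ a → 1 ≤ b → a + b ≤ 1) → a + b ≤ 1
    bound zero    b       _  b≤ _ = b≤
    bound (suc a) zero    a≤ _  _ = ≤-trans (≤-reflexive (+-identityʳ (suc a))) a≤
    bound (suc a) (suc b) _  _  f = f (s≤s z≤n) (s≤s z≤n)

  thin-path : ∀ s v → ∃ λ (p : Path s v) → Thin p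
  thin-path s v with em {s ≡ v}
  ... | yes refl = path [] tt refl , λ _ → z≤n
  ... | no s≢v with m , (cons , eff , nr) , prod ← Ma s≢v =
    path m (stepwise⇒effective m eff) prod , concise⇒thin cons nr

  -- Counts are compared by closing both paths with the same path from v back to s.
  transfer : ∀ {s v} (p q : Path s v) z → #ₚ z p + #ₚ (rev z) q ≡ #ₚ (rev z) p + #ₚ z q
  transfer {s} {v} p q z = +-cancelʳ-≡ (#ₚ z r + #ₚ (rev z) r) _ _ $ begin
    (a + b′) + (c + c′) ≡⟨ interchange a b′ c c′ ⟩
    (a + c) + (b′ + c′) ≡⟨ cong₂ _+_ (closed p) (sym (closed q)) ⟩
    (a′ + c′) + (b + c) ≡⟨ interchange a′ c′ b c ⟩
    (a′ + b) + (c′ + c) ≡⟨ cong ((a′ + b) +_) (+-comm c′ c) ⟩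
    (a′ + b) + (c + c′) ∎
    where
    open ≡-Reasoning
    r = proj₁ (thin-path v s)
    a  = #ₚ z p ; a′ = #ₚ (rev z) p
    b  = #ₚ z q ; b′ = #ₚ (rev z) q
    c  = #ₚ z r ; c′ = #ₚ (rev z) r
    closed : (p : Path s v) → #ₚ z p + c ≡ #ₚ (rev z) p + c′
    closed p = trans (sym (count-++ (_≈ z) (message p) (message r)))
      (trans (vacuous⇒balanced (message p ++ message r) (closed-vacuous (p ++ₚ r)) z)
        (count-++ (_≈ rev z) (message p) (message r)))

  closed-even : ∀ {s} (p : Path s s) → isOdd ∣ p ∣ₚ ≡ false
  closed-even p with k , eq ← matched-even MutualReverses (message p) (closed-vacuous p) =
    trans (cong isOdd eq) (trans (isOdd-+ k k) (xor-same (isOdd k)))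

  -- By `transfer` both paths have the same difference between the uses of `z` and of `rev z`. For
  -- the thin path `#ₚ z p` is the positive part of this difference, hence at most `#ₚ z q`; this
  -- holds for every `z`.
  thin⇒shortest : ∀ {s v} (p q : Path s v) → Thin p → ∣ p ∣ₚ ≤ ∣ q ∣ₚ
  thin⇒shortest p q thin = count-mono⇒length-mono (message p) (message q) λ z →
    bound _ _ (transfer p q z) (thin z)
    where
    bound : ∀ a b {c d} → a + d ≡ b + c → a + b ≤ 1 → a ≤ c
    bound zero    _       _  _        = z≤n
    bound (suc a) zero    eq _        = ≤-trans (m≤m+n (suc a) _) (≤-reflexive eq)
    bound (suc a) (suc b) _  (s≤s le) = contradiction (≤-trans (m≤n+m (suc b) a) le) λ ()

  -- The graph of a medium: connectedness, bipartiteness, distance.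

  graph : Graph S
  graph = record
    { _~_      = AdjacentTo
    ; sym      = λ (s≢t , τ , τ∈𝒯 , τs≡t) → let ρ , ρ∈𝒯 = rev (τ , τ∈𝒯) in
        s≢t ∘ sym , ρ , ρ∈𝒯 , back (τ , τ∈𝒯) s≢t τs≡t
    ; loopless = λ s≡t (s≢t , _) → s≢t s≡t
    }

  open Graph graph using (_~_; Walk; []; _∷_; Distance; Connected; Bipartite; Like; arc)
  open Walks graph using (distance-unique)

  path⇒walk : ∀ {s v} (p : Path s v) → Walk s v ∣ p ∣ₚ
  path⇒walk (path []      _          refl) = []
  path⇒walk (path (x ∷ m) (ne , eff) prod) =
    (ne ∘ sym , proj₁ x , proj₂ x , refl) ∷ path⇒walk (path m eff prod)

  walk⇒path : ∀ {s v n} → Walk s v n → ∃ λ (p : Path s v) → ∣ p ∣ₚ ≡ n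
  walk⇒path []                          = path [] tt refl , refl
  walk⇒path ((s≢t , τ , τ∈𝒯 , τs≡t) ∷ w) with p , eq ← walk⇒path w =
    step (τ , τ∈𝒯) s≢t τs≡t ++ₚ p , cong suc eq

  connected : Connected
  connected s v = _ , path⇒walk (proj₁ (thin-path s v))

  -- The colour of a state is the parity of a thin path from `root`. If the ends of an edge had
  -- equal colours, the closed paths `q ++ₚ r` and `p ++ₚ (e ++ₚ r)` would differ in parity, but
  -- both are even.
  bipartite : Bipartite
  bipartite = (λ s → isOdd ∣ proj₁ (thin-path root s) ∣ₚ) , λ {s} {t} → separated s t
    where
    separated : ∀ s t → s ~ t →
                isOdd ∣ proj₁ (thin-path root s) ∣ₚ ≢ isOdd ∣ proj₁ (thin-path root t) ∣ₚ
    separated s t (s≢t , τ , τ∈𝒯 , τs≡t) same = contradiction (begin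
        true                                ≡⟨ cong not (closed (q ++ₚ r)) ⟨
        not (isOdd ∣ q ++ₚ r ∣ₚ)             ≡⟨ cong not (split q r) ⟩
        not (isOdd ∣ q ∣ₚ xor isOdd ∣ r ∣ₚ)  ≡⟨ cong (λ b → not (b xor isOdd ∣ r ∣ₚ)) same ⟨
        not (isOdd ∣ p ∣ₚ xor isOdd ∣ r ∣ₚ)  ≡⟨ cong not (isOdd-+ ∣ p ∣ₚ ∣ r ∣ₚ) ⟨
        isOdd (suc (∣ p ∣ₚ + ∣ r ∣ₚ))        ≡⟨ cong isOdd (+-suc ∣ p ∣ₚ ∣ r ∣ₚ) ⟨
        isOdd (∣ p ∣ₚ + ∣ e ++ₚ r ∣ₚ)        ≡⟨ isOdd-+ ∣ p ∣ₚ ∣ e ++ₚ r ∣ₚ ⟩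
        isOdd ∣ p ∣ₚ xor isOdd ∣ e ++ₚ r ∣ₚ  ≡⟨ split p (e ++ₚ r) ⟨
        isOdd ∣ p ++ₚ (e ++ₚ r) ∣ₚ           ≡⟨ closed (p ++ₚ (e ++ₚ r)) ⟩
        false                               ∎) λ ()
      where
      open ≡-Reasoning
      closed : (p : Path root root) → isOdd ∣ p ∣ₚ ≡ false
      closed = closed-even
      p = proj₁ (thin-path root s)
      q = proj₁ (thin-path root t)
      r = proj₁ (thin-path t root)
      e = step (τ , τ∈𝒯) s≢t τs≡t
      split : ∀ {u v w} (p : Path u v) (q : Path v w) → isOdd ∣ p ++ₚ q ∣ₚ ≡ isOdd ∣ p ∣ₚ xor isOdd ∣ q ∣ₚ
      split p q = trans (cong isOdd (length-++ (message p))) (isOdd-+ ∣ p ∣ₚ ∣ q ∣ₚ)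

  thin-distance : ∀ {s v} (p : Path s v) → Thin p → Distance s v ∣ p ∣ₚ
  thin-distance p thin = path⇒walk p , λ w →
    subst (∣ p ∣ₚ ≤_) (proj₂ (walk⇒path w)) (thin⇒shortest p (proj₁ (walk⇒path w)) thin)

  -- Serves to discard the wrong alternative of `sides`: a state one step nearer to `s` than to `t`
  -- cannot also be one step nearer to `t`.
  no-gap : ∀ {s t v n} (p : Path t v) → Thin p → Distance s v n → Distance t v (n + 1) →
           ¬ Distance s v (suc ∣ p ∣ₚ)
  no-gap {n = n} p thin δsv δtv δsv′ = m≢1+m+n n (begin
    n            ≡⟨ distance-unique δsv δsv′ ⟩
    suc ∣ p ∣ₚ   ≡⟨ cong suc (distance-unique (thin-distance p thin) δtv) ⟩
    suc (n + 1)  ∎)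
    where open ≡-Reasoning

  #-cong : ∀ {x y} → x ≈ y → ∀ m → # x m ≡ # y m
  #-cong {x} {y} x≈y = count-cong
    (λ z z≈x → ≈.trans {z} {x} {y} z≈x x≈y)
    (λ z z≈y → ≈.trans {z} {y} {x} z≈y (≈.sym {x} {y} x≈y))

  thin-∷ : ∀ x m → (∀ z → # z m + # (rev z) m ≤ 1) → # x m ≡ 0 → # (rev x) m ≡ 0 →
           ∀ z → # z (x ∷ m) + # (rev z) (x ∷ m) ≤ 1
  thin-∷ x m thin #x≡0 #x̃≡0 z with em {x ≈ z} | em {x ≈ rev z}
  ... | yes x≈z | yes x≈z̃ = contradiction (≈.trans {z} {x} {rev z} (≈.sym {x} {z} x≈z) x≈z̃) (rev-≉ {z})
  ... | yes x≈z | no _ = ≤-reflexive (cong suc (cong₂ _+_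
    (trans (sym (#-cong {x} {z} x≈z m)) #x≡0)
    (trans (sym (#-cong {rev x} {rev z} (rev-cong {x} {z} x≈z) m)) #x̃≡0)))
  ... | no _ | yes x≈z̃ = ≤-reflexive (cong₂ (λ a b → a + suc b)
    (trans (sym (#-cong {rev x} {z} (swap-rev {x} {z} x≈z̃) m)) #x̃≡0)
    (trans (sym (#-cong {x} {rev z} x≈z̃ m)) #x≡0))
  ... | no _ | no _ = thin z

  χ-refl : ∀ x → χ (x ≈ x) ≡ 1
  χ-refl x = χ-yes (λ _ → refl)

  χ-rev-≉ : ∀ x → χ (x ≈ rev x) ≡ 0
  χ-rev-≉ x = χ-no (rev-≉ {x})

  -- For an edge from s to t labelled x and a further state v, a thin path from s to v either
  -- avoids x, and then v is nearer to s, or uses x, and then v is nearer to t.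
  module Edge {s t} (x : Token) (s≢t : s ≢ t) (sx≡t : s · x ≡ t) where

    edge : Path s t
    edge = step x s≢t sx≡t

    edge-transfer : ∀ {v} (u : Path s v) (h : Path t v) →
                    suc (#ₚ x h) + #ₚ (rev x) u ≡ #ₚ (rev x) h + #ₚ x u
    edge-transfer u h = subst₂ (λ a b → (a + #ₚ x h) + #ₚ (rev x) u ≡ (b + #ₚ (rev x) h) + #ₚ x u)
      (χ-refl x) (χ-rev-≉ x) (transfer (edge ++ₚ h) u x)

    -- With no `x` in `u`, `edge-transfer` makes `#ₚ (rev x) h` exceed `#ₚ (rev x) u`, while
    -- thinness of `h` keeps it at most one.
    near⇒no-rev : ∀ {v} (u : Path s v) → #ₚ x u ≡ 0 → #ₚ (rev x) u ≡ 0
    near⇒no-rev {v} u #x≡0 with h , thin ← thin-path t v = bound _ _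
      (trans (edge-transfer u h) (trans (cong (#ₚ (rev x) h +_) #x≡0) (+-identityʳ _))) (thin x)
      where
      bound : ∀ a b {c} → suc a + b ≡ c → a + c ≤ 1 → b ≡ 0
      bound a b refl a+c≤1 = n≤0⇒n≡0 (≤-trans (m≤n+m b a) (s≤s⁻¹ (≤-trans (m≤n+m _ a) a+c≤1)))

    -- Neither `x` nor its reverse occurs in `u`, so `u` preceded by `rev x` is still thin and
    -- therefore shortest.
    near-distance : ∀ {v} (u : Path s v) → Thin u → #ₚ x u ≡ 0 → Distance t v (suc ∣ u ∣ₚ)
    near-distance u thin #x≡0 = thin-distance (step (rev x) (s≢t ∘ sym) (back x s≢t sx≡t) ++ₚ u)
      (thin-∷ (rev x) (message u) thin (near⇒no-rev u #x≡0)
        (trans (#-cong {rev (rev x)} {x} (rev-involutive x) (message u)) #x≡0))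

    -- If both counts were positive, thinness would make them one and the other two counts zero, and
    -- `edge-transfer` would read 1 = 2.
    sides : ∀ {v} (u : Path s v) (h : Path t v) → Thin u → Thin h → #ₚ x u ≡ 0 ⊎ #ₚ (rev x) h ≡ 0
    sides u h thin-u thin-h = bound _ _ _ _ (edge-transfer u h) (thin-h x) (thin-u x)
      where
      bound : ∀ a b c d → suc a + b ≡ c + d → a + c ≤ 1 → d + b ≤ 1 → d ≡ 0 ⊎ c ≡ 0
      bound _             _    _             zero          _  _        _      = inj₁ refl
      bound _             _    zero          (suc _)       _  _        _      = inj₂ refl
      bound zero          _    (suc (suc _)) (suc _)       _  (s≤s ()) _
      bound zero          zero (suc zero)    (suc zero)    () _        _
      bound zero          _    (suc zero)    (suc (suc _)) _  _        (s≤s ())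
      bound zero          (suc _) (suc zero) (suc zero)    _  _        (s≤s ())
      bound (suc zero)    _    (suc _)       (suc _)       _  (s≤s ()) _
      bound (suc (suc _)) _    (suc _)       (suc _)       _  (s≤s ()) _

    -- `u` followed by `x` is compared with a thin path `k` to `q`: a use of `x` in `u` would force
    -- at least two uses of `x` in `k`.
    parallel⇒near : ∀ {p q} → p ≢ q → p · x ≡ q → (u : Path s p) → Thin u → #ₚ x u ≡ 0
    parallel⇒near {p} {q} p≢q px≡q u thin-u with k , thin-k ← thin-path s q =
      bound _ _ _ _ (subst₂ (λ a b → a + #ₚ (rev x) k ≡ b + #ₚ x k)
        (trans (count-++ (_≈ x) (message u) (x ∷ [])) (cong (λ a → #ₚ x u + (a + 0)) (χ-refl x)))
        (trans (count-++ (_≈ rev x) (message u) (x ∷ [])) (cong (λ a → #ₚ (rev x) u + (a + 0)) (χ-rev-≉ x)))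
        (transfer (u ++ₚ step x p≢q px≡q) k x)) (thin-u x) (thin-k x)
      where
      bound : ∀ a b c d → (a + 1) + b ≡ (c + 0) + d → a + c ≤ 1 → d + b ≤ 1 → a ≡ 0
      bound zero          _ _       _             _  _        _        = refl
      bound (suc zero)    _ zero    (suc (suc _)) _  _        (s≤s ())
      bound (suc zero)    _ zero    (suc zero)    () _        _
      bound (suc zero)    _ (suc _) _             _  (s≤s ()) _
      bound (suc (suc _)) _ _       _             _  (s≤s ()) _

  -- Arcs are like exactly if one token moves along both.

  module _ {s t p q : S} (x : Token) (s≢t : s ≢ t) (sx≡t : s · x ≡ t) (e : s ~ t) (f : p ~ q) where

    private
      module E = Edge x s≢t sx≡t
      module Ẽ = Edge (rev x) (s≢t ∘ sym) (back x s≢t sx≡t)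

    -- By `sides` and the given distances, `u` avoids `x` and `l` avoids `rev x`. The two ways from
    -- `s` to `q`, through `p` and through `t`, have the same balance of `x`, which is positive for
    -- the second; so the step from `p` to `q` has to be a use of `x`.
    like⇒moves : Like (arc e) (arc f) → p · x ≡ q
    like⇒moves (n , δsp , δtq , δsq , δtp)
      with u , thin-u ← thin-path s p | h , thin-h ← thin-path t p
         | k , thin-k ← thin-path s q | l , thin-l ← thin-path t q
      = trans (sym (y≈x p)) py≡q
      where
      y : Token
      y = proj₁ (proj₂ f) , proj₁ (proj₂ (proj₂ f))
      py≡q : p · y ≡ q
      py≡q = proj₂ (proj₂ (proj₂ f))
      #x-u : #ₚ x u ≡ 0
      #x-u = fromInj₁ (λ z → ⊥-elim (no-gap h thin-h δsp δtp (Ẽ.near-distance h thin-h z)))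
                      (E.sides u h thin-u thin-h)
      #x̃-l : #ₚ (rev x) l ≡ 0
      #x̃-l = fromInj₂ (λ z → ⊥-elim (no-gap k thin-k δtq δsq (E.near-distance k thin-k z)))
                      (E.sides k l thin-k thin-l)
      y≈x : y ≈ x
      y≈x with em {y ≈ x}
      ... | yes eq = eq
      ... | no neq = contradiction (begin
        0
          ≡⟨ cong₂ _+_ (cong₂ (λ a b → a + (b + 0)) #x-u (χ-no neq)) (cong₂ _+_ (χ-rev-≉ x) #x̃-l) ⟨
        (#ₚ x u + (χ (y ≈ x) + 0)) + #ₚ (rev x) (E.edge ++ₚ l)
          ≡⟨ cong (_+ #ₚ (rev x) (E.edge ++ₚ l)) (count-++ (_≈ x) (message u) (y ∷ [])) ⟨
        #ₚ x (u ++ₚ last) + #ₚ (rev x) (E.edge ++ₚ l)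
          ≡⟨ transfer (u ++ₚ last) (E.edge ++ₚ l) x ⟩
        #ₚ (rev x) (u ++ₚ last) + #ₚ x (E.edge ++ₚ l)
          ≡⟨ cong (λ a → #ₚ (rev x) (u ++ₚ last) + (a + #ₚ x l)) (χ-refl x) ⟩
        #ₚ (rev x) (u ++ₚ last) + suc (#ₚ x l)
          ≡⟨ +-suc _ _ ⟩
        suc (#ₚ (rev x) (u ++ₚ last) + #ₚ x l) ∎) λ ()
        where
        open ≡-Reasoning
        last = step y (proj₁ f) py≡q

    -- `parallel⇒near`, applied to the edge and to its reversal, puts `p` on the side of `s` and `q`
    -- on that of `t`. The lengths of `u` and `l` agree because either path, prolonged by `x` or
    -- `rev x`, competes with a shortest path one longer than the other.
    moves⇒like : p · x ≡ q → Like (arc e) (arc f)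
    moves⇒like px≡q with u , thin-u ← thin-path s p | l , thin-l ← thin-path t q =
      ∣ u ∣ₚ , thin-distance u thin-u
      , subst (Distance t q) ∣l∣≡∣u∣ (thin-distance l thin-l)
      , subst (Distance s q) (trans (cong suc ∣l∣≡∣u∣) (+-comm 1 _)) (Ẽ.near-distance l thin-l #x̃-l)
      , subst (Distance t p) (+-comm 1 _) (E.near-distance u thin-u #x-u)
      where
      p≢q = proj₁ f
      #x-u : #ₚ x u ≡ 0
      #x-u = E.parallel⇒near p≢q px≡q u thin-u
      #x̃-l : #ₚ (rev x) l ≡ 0
      #x̃-l = Ẽ.parallel⇒near (p≢q ∘ sym) (back x p≢q px≡q) l thin-l
      ∣l∣≡∣u∣ : ∣ l ∣ₚ ≡ ∣ u ∣ₚ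
      ∣l∣≡∣u∣ = ≤-antisym
        (s≤s⁻¹ (≤-trans (proj₂ (Ẽ.near-distance l thin-l #x̃-l)
            (path⇒walk (u ++ₚ step x p≢q px≡q)))
          (≤-reflexive (trans (length-++ (message u)) (+-comm _ 1)))))
        (s≤s⁻¹ (≤-trans (proj₂ (E.near-distance u thin-u #x-u)
            (path⇒walk (l ++ₚ step (rev x) (p≢q ∘ sym) (back x p≢q px≡q))))
          (≤-reflexive (trans (length-++ (message l)) (+-comm _ 1)))))

  -- The token of the first arc moves along the second and hence along the third.
  likeTransitive : Transitive Like
  likeTransitive {arc e@(s≢t , τ , τ∈𝒯 , τs≡t)} {arc f@(p≢q , _)} {arc g} e∼f f∼g =
    moves⇒like x s≢t τs≡t e g (like⇒moves x p≢q (like⇒moves x s≢t τs≡t e f e∼f) f g f∼g)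
    where
    x : Token
    x = τ , τ∈𝒯

  mediaticGraph : MediaticGraph S
  mediaticGraph = record
    { graph          = graph
    ; connected      = connected
    ; bipartite      = bipartite
    ; likeTransitive = λ {a} {b} {c} → likeTransitive {a} {b} {c}
    }

  arc-token : ∀ {s t} (x : Token) (e : s ~ t) → s · x ≡ t → Graph.IsTokenOf graph (arc e) (proj₁ x)
  arc-token {s} {t} x e sx≡t = record
    { moves = λ f → like⇒moves x (proj₁ e) sx≡t e f
    ; fixes = λ {p} none → em⇒dne em λ px≢p →
        let f = px≢p ∘ sym , proj₁ x , proj₂ x , refl in
        none (p · x , f , moves⇒like x (proj₁ e) sx≡t e f refl)
    }

  isMediumOf-mediaticGraph : M IsMediumOf mediaticGraph
  isMediumOf-mediaticGraph =
    (λ {τ} τ∈𝒯 → let x = τ , τ∈𝒯 ; s , sx≢s = moved x ; e = sx≢s ∘ sym , τ , τ∈𝒯 , refl in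
      arc e , arc-token x e refl) ,
    λ { (arc e@(_ , τ , τ∈𝒯 , τs≡t)) → τ , arc-token (τ , τ∈𝒯) e τs≡t , τ∈𝒯 }

-- From a mediatic graph to its medium: distances, halfspaces and the functions of arcs.

module GraphMedium {ℓ : Level} (em : ExcludedMiddle ℓ) {S : Set ℓ} (G : MediaticGraph S) where

  open MediaticGraph G renaming (sym to ~-sym)
  open Classical em
  open Walks graph

  shortest : ∀ {s t} n → Walk s t n → ∃ (Distance s t)
  shortest {s} {t} = <-rec _ λ n rec w → least n rec w em
    where
    least : ∀ n → (∀ {k} → k < n → Walk s t k → ∃ (Distance s t)) → Walk s t n →
            Dec (∃ λ k → k < n × Walk s t k) → ∃ (Distance s t)
    least n rec w (yes (k , k<n , w′)) = rec k<n w′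
    least n rec w (no none)            = n , w , λ {k} w′ → ≮⇒≥ λ k<n → none (k , k<n , w′)

  abstract
    distance : ∀ s t → ∃ (Distance s t)
    distance s t = shortest _ (proj₂ (connected s t))

  δ : S → S → ℕ
  δ s t = proj₁ (distance s t)

  δ-distance : ∀ s t → Distance s t (δ s t)
  δ-distance s t = proj₂ (distance s t)

  δ-unique : ∀ {s t n} → Distance s t n → δ s t ≡ n
  δ-unique = distance-unique (δ-distance _ _)

  δ-walk : ∀ s t → Walk s t (δ s t)
  δ-walk s t = proj₁ (δ-distance s t)

  δ-≤ : ∀ {s t n} → Walk s t n → δ s t ≤ n
  δ-≤ = proj₂ (δ-distance _ _)

  δ-sym : ∀ s t → δ s t ≡ δ t s
  δ-sym s t = δ-unique (distance-sym (δ-distance t s))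

  δ-refl : ∀ s → δ s s ≡ 0
  δ-refl s = n≤0⇒n≡0 (δ-≤ [])

  δ≡0⇒≡ : ∀ s t → δ s t ≡ 0 → s ≡ t
  δ≡0⇒≡ s t eq with [] ← subst (Walk s t) eq (δ-walk s t) = refl

  ~⇒≢ : ∀ {s t} → s ~ t → s ≢ t
  ~⇒≢ e s≡t = loopless s≡t e

  δ-edge : ∀ {s t} → s ~ t → δ s t ≡ 1
  δ-edge {s} {t} e = ≤-antisym (δ-≤ (e ∷ [])) (n≢0⇒n>0 (~⇒≢ e ∘ δ≡0⇒≡ s t))

  δ-stepˡ : ∀ {s t} p → s ~ t → δ s p ≤ suc (δ t p)
  δ-stepˡ p e = δ-≤ (e ∷ δ-walk _ p)

  δ-stepʳ : ∀ {s t} p → s ~ t → δ p s ≤ suc (δ p t)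
  δ-stepʳ p e = subst₂ _≤_ (δ-sym _ p) (cong suc (δ-sym _ p)) (δ-stepˡ p e)

  colour : S → Bool
  colour = proj₁ bipartite

  -- Walks of equal length to `p` flip the colour equally often, so they would give `s` and `t` the
  -- same colour.
  δ-parity : ∀ {s t} p → s ~ t → δ s p ≢ δ t p
  δ-parity {s} {t} p e eq = proj₂ bipartite e
    (flips-injective (δ t p)
      (trans (sym (walk-colour (subst (Walk s p) eq (δ-walk s p)))) (walk-colour (δ-walk t p))))
    where
    flips : ℕ → Bool → Bool
    flips zero    b = b
    flips (suc n) b = flips n (not b)
    flips-injective : ∀ n {b c} → flips n b ≡ flips n c → b ≡ c
    flips-injective zero    eq = eq
    flips-injective (suc n) eq = not-injective (flips-injective n eq)
    walk-colour : ∀ {s t n} → Walk s t n → colour t ≡ flips n (colour s)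
    walk-colour []                  = refl
    walk-colour {n = suc n} (e ∷ w) =
      trans (walk-colour w) (cong (flips n) (¬-not (proj₂ bipartite (~-sym e))))

  -- p lies in the halfspace of the states nearer to s than to t.
  Near : S → S → S → Set
  Near s t p = δ t p ≡ suc (δ s p)

  near⊎near : ∀ {s t} p → s ~ t → Near s t p ⊎ Near t s p
  near⊎near {s} {t} p e with ≤-<-connex (δ s p) (δ t p)
  ... | inj₁ le = inj₁ (≤-antisym (δ-stepˡ p (~-sym e)) (≤∧≢⇒< le (δ-parity p e)))
  ... | inj₂ lt = inj₂ (≤-antisym (δ-stepˡ p e) lt)

  near-disjoint : ∀ {s t p} → Near s t p → ¬ Near t s p
  near-disjoint {s} {t} {p} eq eq′ = m≢1+m+n (δ t p) {1} (trans eq (cong suc (trans eq′ (+-comm 1 _))))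

  near-source : ∀ {s t} → s ~ t → Near s t s
  near-source {s} {t} e = trans (δ-edge (~-sym e)) (cong suc (sym (δ-refl s)))

  -- The like relation says that the second arc crosses between the two halfspaces of the first.
  like⇒near : ∀ {s t p q} (e : s ~ t) (f : p ~ q) → Like (arc e) (arc f) → Near s t p × Near t s q
  like⇒near e f (n , δsp , δtq , δsq , δtp) =
    near δtp δsp , near δsq δtq
    where
    near : ∀ {s t p} → Distance t p (n + 1) → Distance s p n → Near s t p
    near d d′ = trans (δ-unique d) (trans (+-comm n 1) (cong suc (sym (δ-unique d′))))

  near⇒like : ∀ {s t p q} (e : s ~ t) (f : p ~ q) → Near s t p → Near t s q → Like (arc e) (arc f)
  near⇒like {s} {t} {p} {q} e f near far =
    δ s p , δ-distance s p
    , subst (Distance t q) (sym δsp≡δtq) (δ-distance t q)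
    , subst (Distance s q) (trans far (trans (cong suc (sym δsp≡δtq)) (+-comm 1 _))) (δ-distance s q)
    , subst (Distance t p) (trans near (+-comm 1 _)) (δ-distance t p)
    where
    -- Crossing `f` changes the distance from `t`, and likewise that from `s`, by at most one; the
    -- two bounds give the two inequalities.
    δsp≡δtq : δ s p ≡ δ t q
    δsp≡δtq = ≤-antisym
      (s≤s⁻¹ (≤-trans (≤-reflexive (sym near)) (δ-stepʳ t f)))
      (s≤s⁻¹ (≤-trans (≤-reflexive (sym far)) (δ-stepʳ s (~-sym f))))

  like-refl : Reflexive Like
  like-refl {arc e} = near⇒like e e (near-source e) (near-source (~-sym e))

  like-flip : ∀ {s t p q} (e : s ~ t) (f : p ~ q) →
              Like (arc e) (arc f) → Like (arc (~-sym e)) (arc (~-sym f))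
  like-flip e f l with near , far ← like⇒near e f l = near⇒like (~-sym e) (~-sym f) far near

  -- Transitivity makes the arcs to `q` and `q′` like each other, so `q′` is nearer to `q` than to
  -- its neighbour `p` and coincides with `q`. This is what makes the function of an arc
  -- single-valued.
  like-target-unique : ∀ a {p q q′} (f : p ~ q) (f′ : p ~ q′) → Like a (arc f) → Like a (arc f′) → q ≡ q′
  like-target-unique a {p} {q} {q′} f f′ l l′ = δ≡0⇒≡ q q′ (suc-injective (trans (sym far) (δ-edge f′)))
    where
    far : Near q p q′
    far = proj₂ (like⇒near f f′ (likeTransitive {arc f} {a} {arc f′} (like-sym {a} {arc f} l) l′))

  Moved : Arc → S → Set ℓ
  Moved a p = ∃₂ λ q (f : p ~ q) → Like a (arc f)

  abstract
    token : ∀ a → ∃ (IsTokenOf a)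
    token a = (λ p → move (em {Moved a p})) , record
      { moves = λ {p} f l → move-moves f l em
      ; fixes = λ {p} none → move-fixes none em
      }
      where
      move : ∀ {p} → Dec (Moved a p) → S
      move     (yes (q , _)) = q
      move {p} (no _)        = p
      move-moves : ∀ {p q} (f : p ~ q) → Like a (arc f) → (d : Dec (Moved a p)) → move d ≡ q
      move-moves f l (yes (_ , f′ , l′)) = like-target-unique a f′ f l′ l
      move-moves f l (no none)           = contradiction (_ , f , l) none
      move-fixes : ∀ {p} → ¬ Moved a p → (d : Dec (Moved a p)) → move d ≡ p
      move-fixes none (yes m) = contradiction m none
      move-fixes none (no _)  = refl

  -- States without a like arc are fixed, so a moved state has one, and `moves` identifies its
  -- target.
  moves⁻¹ : ∀ {a τ p q} → IsTokenOf a τ → p ≢ q → τ p ≡ q → ∃ λ (f : p ~ q) → Like a (arc f)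
  moves⁻¹ {a} {τ} {p} {q} τ-a p≢q τp≡q with em {Moved a p}
  ... | no none = contradiction (trans (sym (IsTokenOf.fixes τ-a none)) τp≡q) p≢q
  ... | yes (q′ , f , l) with refl ← trans (sym (IsTokenOf.moves τ-a f l)) τp≡q = f , l

  token-source : ∀ {s t τ} (e : s ~ t) → IsTokenOf (arc e) τ → τ s ≡ t
  token-source e τ-e = IsTokenOf.moves τ-e e (like-refl {arc e})

  like⇒token : ∀ {a b τ} → Like a b → IsTokenOf a τ → IsTokenOf b τ
  like⇒token {a} {b} l τ-a = record
    { moves = λ f l′ → IsTokenOf.moves τ-a f (likeTransitive {a} {b} {arc f} l l′)
    ; fixes = λ none → IsTokenOf.fixes τ-a λ (q , f , l′) →
        none (q , f , likeTransitive {b} {a} {arc f} (like-sym {a} {b} l) l′)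
    }

  token-unique : ∀ {a τ σ} → IsTokenOf a τ → IsTokenOf a σ → τ ≗ σ
  token-unique {a} τ-a σ-a p with em {Moved a p}
  ... | yes (q , f , l) = trans (IsTokenOf.moves τ-a f l) (sym (IsTokenOf.moves σ-a f l))
  ... | no none         = trans (IsTokenOf.fixes τ-a none) (sym (IsTokenOf.fixes σ-a none))

  -- The token system of the functions of arcs.

  module _ {s₀ t₀ : S} (s₀≢t₀ : s₀ ≢ t₀) where

    tokenSystem : TokenSystem S
    tokenSystem = record
      { 𝒯           = λ τ → ∃ λ a → IsTokenOf a τ
      ; respects    = λ τ≗σ (a , τ-a) → a , record
        { moves = λ {p} f l → trans (sym (τ≗σ p)) (IsTokenOf.moves τ-a f l)
        ; fixes = λ {p} none → trans (sym (τ≗σ p)) (IsTokenOf.fixes τ-a none)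
        }
      ; nonIdentity = λ (arc e , τ-e) τ≗id → ~⇒≢ e (trans (sym (τ≗id _)) (token-source e τ-e))
      ; nonempty    = proj₁ (token some-arc) , some-arc , proj₂ (token some-arc)
      }
      where
      -- A walk between the two distinct states is not empty; its first arc shows that there is a
      -- token.
      first-arc : ∀ {s t n} → s ≢ t → Walk s t n → Arc
      first-arc s≢t []      = contradiction refl s≢t
      first-arc s≢t (e ∷ _) = arc e
      some-arc : Arc
      some-arc = first-arc s₀≢t₀ (δ-walk s₀ t₀)

    open TokenSystem tokenSystem
    open Tokens em tokenSystem

    arcOf : Token → Arc
    arcOf (_ , a , _) = a

    isToken : (x : Token) → IsTokenOf (arcOf x) (proj₁ x)
    isToken (_ , _ , τ-a) = τ-a

    tokenOf : Arc → Token
    tokenOf a = proj₁ (token a) , a , proj₂ (token a)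

    flip : Arc → Arc
    flip (arc e) = arc (~-sym e)

    rev : Token → Token
    rev x = tokenOf (flip (arcOf x))

    adjacent⇒~ : ∀ {s v} → Adjacent s v → s ~ v
    adjacent⇒~ (inj₁ (s≢v , τ , (a , τ-a) , τs≡v)) = proj₁ (moves⁻¹ τ-a s≢v τs≡v)
    adjacent⇒~ (inj₂ (v≢s , τ , (a , τ-a) , τv≡s)) = ~-sym (proj₁ (moves⁻¹ τ-a v≢s τv≡s))

    rev-reverse : ∀ x → Reverse (rev x) x
    rev-reverse x adj = mk⇔
      (λ sx≡v → let f , l = moves⁻¹ (isToken x) (~⇒≢ (adjacent⇒~ adj)) sx≡v in
        IsTokenOf.moves (isToken (rev x)) (~-sym f) (like-flip (Arc.edge (arcOf x)) f l))
      (λ vx̃≡s → let f , l = moves⁻¹ (isToken (rev x)) (~⇒≢ (~-sym (adjacent⇒~ adj))) vx̃≡s in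
        IsTokenOf.moves (isToken x) (~-sym f) (like-flip (~-sym (Arc.edge (arcOf x))) f l))

    -- Otherwise `rev x` would also move the source of `e` to its target, and likeness with the
    -- reversed arc would put that source nearer to the target than to itself.
    rev-≉ : ∀ {x} → ¬ (x ≈ rev x)
    rev-≉ {x@(τ , arc e , τ-e)} x≈x̃
      with f , l ← moves⁻¹ (isToken (rev x)) (~⇒≢ e) (trans (sym (x≈x̃ _)) (token-source e τ-e)) =
      near-disjoint (near-source e) (proj₁ (like⇒near (~-sym e) f l))

    open Reversible rev rev-reverse (λ {x} → rev-≉ {x})

    same-step : ∀ {p q} x y → p ≢ q → p · x ≡ q → p · y ≡ q → x ≈ y
    same-step x y p≢q px≡q py≡q
      with f , l ← moves⁻¹ (isToken x) p≢q px≡q | f′ , l′ ← moves⁻¹ (isToken y) p≢q py≡q =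
      -- `Like` reads only the endpoints of its arcs, so `l′` serves for `f` as well as for `f′`.
      token-unique (like⇒token {arcOf x} {arc f} l (isToken x)) (like⇒token {arcOf y} {arc f} l′ (isToken y))

    -- Crossings of a halfspace, and returns.

    module Crossing (x : Token) where

      open Arc (arcOf x) renaming (source to s; target to t; edge to e)

      -- `Near` is an equation between natural numbers at the lowest level, whereas `χ` takes
      -- propositions in `Set ℓ`.
      Inside : S → Set ℓ
      Inside p = Lift ℓ (Near s t p)

      module _ {p q} (y : Token) (p≢q : p ≢ q) (py≡q : p · y ≡ q) where

        private
          f : p ~ q
          f = proj₁ (moves⁻¹ (isToken y) p≢q py≡q)

          ≈⇒leaves : y ≈ x → Near s t p × Near t s q
          ≈⇒leaves y≈x with f′ , l ← moves⁻¹ (isToken x) p≢q (trans (sym (y≈x p)) py≡q) =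
            like⇒near e f′ l

          ≈⇒enters : y ≈ rev x → Near t s p × Near s t q
          ≈⇒enters y≈x̃ with f′ , l ← moves⁻¹ (isToken (rev x)) p≢q (trans (sym (y≈x̃ p)) py≡q) =
            like⇒near (~-sym e) f′ l

        leaves : Near s t p → Near t s q → y ≈ x
        leaves near far = same-step y x p≢q py≡q (IsTokenOf.moves (isToken x) f (near⇒like e f near far))

        enters : Near t s p → Near s t q → y ≈ rev x
        enters far near = same-step y (rev x) p≢q py≡q
          (IsTokenOf.moves (isToken (rev x)) f (near⇒like (~-sym e) f far near))

        -- A step within one side is a use neither of `x` nor of `rev x`; a step that changes sides
        -- is a use of one of them, determined by its direction.
        crossing-step : χ (y ≈ x) + χ (Inside q) ≡ χ (y ≈ rev x) + χ (Inside p)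
        crossing-step with near⊎near p e | near⊎near q e
        ... | inj₁ p∈ | inj₁ q∈ = cong₂ _+_
          (trans (χ-no (near-disjoint q∈ ∘ proj₂ ∘ ≈⇒leaves))
                 (sym (χ-no (near-disjoint p∈ ∘ proj₁ ∘ ≈⇒enters))))
          (trans (χ-yes (lift q∈)) (sym (χ-yes (lift p∈))))
        ... | inj₂ p∉ | inj₂ q∉ = cong₂ _+_
          (trans (χ-no (near-disjoint p∉ ∘ proj₁ ∘ ≈⇒leaves))
                 (sym (χ-no (near-disjoint q∉ ∘ proj₂ ∘ ≈⇒enters))))
          (trans (χ-no (near-disjoint q∉ ∘ lower)) (sym (χ-no (near-disjoint p∉ ∘ lower))))
        ... | inj₁ p∈ | inj₂ q∉ = trans
          (cong₂ _+_ (χ-yes (leaves p∈ q∉)) (χ-no (near-disjoint q∉ ∘ lower)))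
          (sym (cong₂ _+_ (χ-no (near-disjoint p∈ ∘ proj₁ ∘ ≈⇒enters)) (χ-yes (lift p∈))))
        ... | inj₂ p∉ | inj₁ q∈ = trans
          (cong₂ _+_ (χ-no (near-disjoint p∉ ∘ proj₁ ∘ ≈⇒leaves)) (χ-yes (lift q∈)))
          (sym (cong₂ _+_ (χ-yes (enters p∉ q∈)) (χ-no (near-disjoint p∉ ∘ lower))))

      -- Each use of x leaves the halfspace of s and each use of its reverse enters it.
      crossings : ∀ {p} m → Effective p m → # x m + χ (Inside (p ·· m)) ≡ # (rev x) m + χ (Inside p)
      crossings []          _          = refl
      crossings {p} (y ∷ m) (ne , eff) = begin
        (χ (y ≈ x) + # x m) + χ (Inside (p · y ·· m))        ≡⟨ +-assoc (χ (y ≈ x)) _ _ ⟩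
        χ (y ≈ x) + (# x m + χ (Inside (p · y ·· m)))        ≡⟨ cong (χ (y ≈ x) +_) (crossings m eff) ⟩
        χ (y ≈ x) + (# (rev x) m + χ (Inside (p · y)))       ≡⟨ cong (χ (y ≈ x) +_) (+-comm (# (rev x) m) _) ⟩
        χ (y ≈ x) + (χ (Inside (p · y)) + # (rev x) m)       ≡⟨ +-assoc (χ (y ≈ x)) _ _ ⟨
        (χ (y ≈ x) + χ (Inside (p · y))) + # (rev x) m       ≡⟨ cong (_+ # (rev x) m) (crossing-step y (ne ∘ sym) refl) ⟩
        (χ (y ≈ rev x) + χ (Inside p)) + # (rev x) m         ≡⟨ +-assoc (χ (y ≈ rev x)) _ _ ⟩
        χ (y ≈ rev x) + (χ (Inside p) + # (rev x) m)         ≡⟨ cong (χ (y ≈ rev x) +_) (+-comm _ (# (rev x) m)) ⟩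
        χ (y ≈ rev x) + (# (rev x) m + χ (Inside p))         ≡⟨ +-assoc (χ (y ≈ rev x)) _ _ ⟨
        (χ (y ≈ rev x) + # (rev x) m) + χ (Inside p)         ∎
        where open ≡-Reasoning

    -- A closed message ends on the side where it starts, so the `Inside` terms of `crossings`
    -- cancel and leave a balanced message.
    return⇒vacuous : ∀ {s m} → Return s m → Vacuous m
    return⇒vacuous {s} {m} (eff , closed) = balanced⇒vacuous m λ x →
      +-cancelʳ-≡ (χ (Crossing.Inside x s)) _ _
        (trans (cong (λ p → # x m + χ (Crossing.Inside x p)) (sym closed))
               (Crossing.crossings x m (stepwise⇒effective m eff)))

    -- Shortest walks give concise messages.

    message : ∀ {s v n} → Walk s v n → Message
    message []      = []
    message (e ∷ w) = tokenOf (arc e) ∷ message w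

    step≡ : ∀ {s t} (e : s ~ t) → s · tokenOf (arc e) ≡ t
    step≡ e = token-source e (proj₂ (token (arc e)))

    message-effective : ∀ {s v n} (w : Walk s v n) → Effective s (message w)
    message-effective []      = tt
    message-effective (e ∷ w) =
      (λ eq → ~⇒≢ e (trans (sym eq) (step≡ e))) ,
      subst (λ t → Effective t (message w)) (sym (step≡ e)) (message-effective w)

    message-produces : ∀ {s v n} (w : Walk s v n) → s ·· message w ≡ v
    message-produces []      = refl
    message-produces (e ∷ w) = trans (cong (_·· message w) (step≡ e)) (message-produces w)

    -- Required of all pairs of entries, the first half is `NoRepetition`, and the second yields
    -- `Consistent`.
    Separated : Token → Token → Set ℓ
    Separated x y = ¬ (x ≈ y) × ¬ (x ≈ rev y)

    -- A shortest walk whose first arc is st stays in the halfspace of t from t on.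
    beyond-separated : ∀ {s t} (e : s ~ t) {p v n} → Near t s v → (w : Walk p v n) → δ t p + n ≤ δ t v →
                       All (Separated (tokenOf (arc e))) (message w)
    beyond-separated e far []      le = []
    beyond-separated {s} {t} e {p} {v} far (_∷_ {t = q} {n = n} f w) le =
      -- `x` moves only states on the side of `s`, but both ends of `f` are on that of `t`; so `x`
      -- is the token neither of `f` nor of its reversal. The bound `le` says that `w` completes a
      -- shortest walk from `t` to `v`.
      ((λ x≈y → disjoint f (beyond p (f ∷ w) le) (trans (x≈y p) (step≡ f))) ,
       (λ x≈ỹ → disjoint (~-sym f) (beyond q w le′) (trans (x≈ỹ q) (step≡ (~-sym f)))))
      ∷ beyond-separated e far w le′
      where
      x = tokenOf (arc e)
      le′ : δ t q + n ≤ δ t v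
      le′ = ≤-trans (+-monoˡ-≤ n (δ-stepʳ t (~-sym f))) (≤-trans (≤-reflexive (sym (+-suc (δ t p) n))) le)
      disjoint : ∀ {p q} (f : p ~ q) → Near t s p → p · x ≢ q
      disjoint f near px≡q with f′ , l ← moves⁻¹ (isToken x) (~⇒≢ f) px≡q =
        near-disjoint near (proj₁ (like⇒near e f′ l))
      beyond : ∀ p {n} → Walk p v n → δ t p + n ≤ δ t v → Near t s p
      beyond p {n} w le with near⊎near p e
      ... | inj₂ near = near
      -- Were `p` nearer to `s`, the walk through `p` would bring `v` nearer to `s` than to `t`,
      -- against `far`.
      ... | inj₁ near = contradiction (begin-strict
        δ t v           <⟨ n<1+n _ ⟩
        suc (δ t v)     ≡⟨ far ⟨
        δ s v           ≤⟨ δ-≤ (walk-++ (δ-walk s p) w) ⟩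
        δ s p + n       ≤⟨ n≤1+n _ ⟩
        suc (δ s p) + n ≡⟨ cong (_+ n) near ⟨
        δ t p + n       ≤⟨ le ⟩
        δ t v           ∎) (<-irrefl refl)
        where open ≤-Reasoning

    -- The first step of a shortest walk comes nearer to `v`, so `v` lies beyond the first arc; the
    -- tail is again shortest.
    shortest-separated : ∀ {s v n} (w : Walk s v n) → n ≤ δ s v → AllPairs Separated (message w)
    shortest-separated []              _  = []
    shortest-separated {s} {v} (_∷_ {t = t} {n = n} e w) le =
      beyond-separated e far w (subst (λ k → k + n ≤ δ t v) (sym (δ-refl t)) le′) ∷ shortest-separated w le′
      where
      le′ : n ≤ δ t v
      le′ = s≤s⁻¹ (≤-trans le (δ-stepˡ v e))
      far : Near t s v
      far = ≤-antisym (δ-stepˡ v e) (≤-trans (s≤s (δ-≤ w)) le)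

    -- A single position is excluded by `rev-≉`, two different ones by the second half of
    -- `Separated`, turned round by `swap-rev` where the order requires it.
    separated⇒consistent : ∀ {m} → AllPairs Separated m → Consistent m
    separated⇒consistent {m} sep {τ} {ρ} τ∈ ρ∈ r = separated sep τ∈ ρ∈ (reverse⇒≈ {ρ} {τ} r)
      where
      separated : ∀ {m x y} → AllPairs Separated m → x ∈ m → y ∈ m → ¬ (y ≈ rev x)
      separated {x = x} _ (here refl) (here refl) = rev-≉ {x}
      separated {x = x} {y} (s ∷ _) (here refl) (there y∈) y≈x̃ = proj₂ (All.lookup s y∈)
        (≈.sym {rev y} {x} (swap-rev {y} {x} y≈x̃))
      separated (s ∷ _)   (there x∈)  (here refl) = proj₂ (All.lookup s x∈)
      separated (_ ∷ sep) (there x∈)  (there y∈)  = separated sep x∈ y∈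

    concise-message : ∀ {s v} → s ≢ v → ∃ λ m → Concise s m × Produces m s v
    concise-message {s} {v} _ =
      message w
      , (separated⇒consistent sep , effective⇒stepwise (message w) (message-effective w) , AllPairs.map proj₁ sep)
      , message-produces w
      where
      w   = δ-walk s v
      sep = shortest-separated w ≤-refl

    medium : Medium S
    medium = record
      { tokenSystem = tokenSystem
      ; Ma          = concise-message
      ; Mb          = return⇒vacuous
      }

    isMediumOf-medium : medium IsMediumOf G
    isMediumOf-medium = (λ τ∈ → τ∈) , λ a → proj₁ (token a) , proj₂ (token a) , a , proj₂ (token a)

-- Transport between graphs with equivalent edge relations.

module Transport {ℓ : Level} {S : Set ℓ} {G H : Graph S} where

  private
    module G = Graph G
    module H = Graph H

  walk-map : (∀ {s t} → s G.~ t → s H.~ t) → ∀ {s t n} → G.Walk s t n → H.Walk s t n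
  walk-map f G.[]      = H.[]
  walk-map f (e G.∷ w) = f e H.∷ walk-map f w

  -- A distance is a minimum over all walks, so carrying it over takes maps of walks in both
  -- directions.
  module _ (f : ∀ {s t} → s G.~ t → s H.~ t) (walk-map⁻¹ : ∀ {s t n} → H.Walk s t n → G.Walk s t n) where

    distance-map : ∀ {s t n} → G.Distance s t n → H.Distance s t n
    distance-map (w , min) = walk-map f w , min ∘ walk-map⁻¹

    like-map : ∀ {s t p q} (e : s G.~ t) (e′ : p G.~ q) (h : s H.~ t) (h′ : p H.~ q) →
               G.Like (G.arc e) (G.arc e′) → H.Like (H.arc h) (H.arc h′)
    like-map e e′ h h′ (n , δsp , δtq , δsq , δtp) =
      n , distance-map δsp , distance-map δtq , distance-map δsq , distance-map δtp

module _ {ℓ : Level} {S : Set ℓ} (G H : MediaticGraph S) (G≈H : G ≈ᴳ H) where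

  private
    module G = MediaticGraph G
    module H = MediaticGraph H
    module G⇒H = Transport {G = G.graph} {H.graph}
    module H⇒G = Transport {G = H.graph} {G.graph}

    f : ∀ {s t} → s G.~ t → s H.~ t
    f = proj₁ G≈H

    g : ∀ {s t} → s H.~ t → s G.~ t
    g = proj₂ G≈H

  isTokenOf-resp-≈ᴳ : ∀ {s t τ} (e : s G.~ t) (h : s H.~ t) →
                      G.IsTokenOf (G.arc e) τ → H.IsTokenOf (H.arc h) τ
  isTokenOf-resp-≈ᴳ e h τ-e = record
    { moves = λ h′ l → G.IsTokenOf.moves τ-e (g h′) (H⇒G.like-map g (G⇒H.walk-map f) h h′ e (g h′) l)
    ; fixes = λ none → G.IsTokenOf.fixes τ-e λ (q , e′ , l) →
        none (q , f e′ , G⇒H.like-map f (H⇒G.walk-map g) e e′ h (f e′) l)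
    }

  isMediumOf-resp-≈ᴳ : ∀ M → M IsMediumOf G → M IsMediumOf H
  isMediumOf-resp-≈ᴳ M (of-arc , has-token) =
    (λ τ∈𝒯 → let G.arc e , τ-e = of-arc τ∈𝒯 in H.arc (f e) , isTokenOf-resp-≈ᴳ e (f e) τ-e) ,
    λ (H.arc e) → let τ , τ-e , τ∈𝒯 = has-token (G.arc (g e)) in
      τ , isTokenOf-resp-≈ᴳ (g e) e τ-e , τ∈𝒯

-- Uniqueness of the medium and of the graph, and the bijection.

module _ {ℓ : Level} (em : ExcludedMiddle ℓ) {S : Set ℓ} where

  open Setoid (mediumSetoid S) using () renaming (_≈_ to _≈ᴹ_)

  -- The arc of `τ` also has its function among the tokens of `N`; it agrees with `τ` pointwise, and
  -- token sets respect that.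
  isMediumOf-⊆ : ∀ M N (G : MediaticGraph S) → M IsMediumOf G → N IsMediumOf G →
                 ∀ {τ} → Medium.𝒯 M τ → Medium.𝒯 N τ
  isMediumOf-⊆ M N G (of-arc , _) (_ , has-token) τ∈M =
    let a , τ-a = of-arc τ∈M ; σ , σ-a , σ∈N = has-token a in
    Medium.respects N (GraphMedium.token-unique em G σ-a τ-a) σ∈N

  isMediumOf-unique : ∀ M N (G : MediaticGraph S) → M IsMediumOf G → N IsMediumOf G → M ≈ᴹ N
  isMediumOf-unique M N G m n = isMediumOf-⊆ M N G m n , isMediumOf-⊆ N M G n m

  isMediumOf⇒isGraphOf : ∀ M (G : MediaticGraph S) → M IsMediumOf G → G IsGraphOf M
  isMediumOf⇒isGraphOf M G (of-arc , has-token) s≢t = mk⇔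
    (λ e → let τ , τ-e , τ∈𝒯 = has-token (arc e) in τ , τ∈𝒯 , token-source e τ-e)
    (λ (τ , τ∈𝒯 , τs≡t) → let a , τ-a = of-arc τ∈𝒯 in proj₁ (moves⁻¹ τ-a s≢t τs≡t))
    where
    open MediaticGraph G using (arc)
    open GraphMedium em G

  isGraphOf-unique : ∀ M (G H : MediaticGraph S) → G IsGraphOf M → H IsGraphOf M → G ≈ᴳ H
  isGraphOf-unique M G H g h =
    (λ e → from (h (G.~⇒≢ e)) (to (g (G.~⇒≢ e)) e)) ,
    (λ e → from (g (H.~⇒≢ e)) (to (h (H.~⇒≢ e)) e))
    where
    module G = GraphMedium em G
    module H = GraphMedium em H

theorem36 : ∀ {ℓ} → ExcludedMiddle ℓ →
    (S : Set ℓ) → (∃₂ λ (s t : S) → s ≢ t) →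
    Σ (Bijection (mediumSetoid S) (mediaticGraphSetoid S)) λ 𝔣 →
    (∀ M → Bijection.to 𝔣 M IsGraphOf M) ×
    (∀ M G → (G ≈ᴳ Bijection.to 𝔣 M × G IsGraphOf M) ⇔ (M IsMediumOf G))
theorem36 em S (s₀ , t₀ , s₀≢t₀) = 𝔣 , isGraphOf , λ M G → mk⇔
  (λ (G≈𝔣M , _) → isMediumOf-resp-≈ᴳ (graphOf M) G (≈ᴳ.sym {G} {graphOf M} G≈𝔣M) M (isMediumOf M))
  (λ m → isGraphOf-unique em M G (graphOf M) (λ {s} {t} → isMediumOf⇒isGraphOf em M G m {s} {t}) (isGraphOf M) ,
         λ {s} {t} → isMediumOf⇒isGraphOf em M G m {s} {t})
  where
  module ≈ᴳ = Setoid (mediaticGraphSetoid S)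
  module ≈ᴹ = Setoid (mediumSetoid S)

  graphOf : Medium S → MediaticGraph S
  graphOf M = MediumGraph.mediaticGraph em M s₀

  isMediumOf : ∀ M → M IsMediumOf graphOf M
  isMediumOf M = MediumGraph.isMediumOf-mediaticGraph em M s₀

  isGraphOf : ∀ M → graphOf M IsGraphOf M
  isGraphOf M {s} {t} = isMediumOf⇒isGraphOf em M (graphOf M) (isMediumOf M) {s} {t}

  graphOf-cong : ∀ {M N} → M ≈ᴹ.≈ N → graphOf M ≈ᴳ graphOf N
  graphOf-cong (M⊆N , N⊆M) =
    (λ (s≢t , τ , τ∈M , τs≡t) → s≢t , τ , M⊆N τ∈M , τs≡t) ,
    (λ (s≢t , τ , τ∈N , τs≡t) → s≢t , τ , N⊆M τ∈N , τs≡t)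

  𝔣 : Bijection (mediumSetoid S) (mediaticGraphSetoid S)
  𝔣 = record
    { to        = graphOf
    ; cong      = λ {M} {N} → graphOf-cong {M} {N}
    ; bijective =
        -- Injectivity: both `M` and `N` are media of `graphOf N`, and a graph has only one.
        (λ {M} {N} 𝔣M≈𝔣N → isMediumOf-unique em M N (graphOf N)
          (isMediumOf-resp-≈ᴳ (graphOf M) (graphOf N) 𝔣M≈𝔣N M (isMediumOf M)) (isMediumOf N)) ,
        -- Surjectivity: the preimage is the medium of `G`. Both `G` and `graphOf N` are graphs of
        -- it, hence equivalent.
        λ G → let N = GraphMedium.medium em G s₀≢t₀ in N , λ {M} M≈N →
          ≈ᴳ.trans {graphOf M} {graphOf N} {G} (graphOf-cong {M} {N} M≈N)
            (isGraphOf-unique em N (graphOf N) G (isGraphOf N)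
              (λ {s} {t} → isMediumOf⇒isGraphOf em N G (GraphMedium.isMediumOf-medium em G s₀≢t₀) {s} {t}))
    }
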